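{- Let $A\in\mathcal{PM}(n)$. If the poset vectors of $A$ have pairwise distinct support sizes (i.e., $|\mathrm{supp}(v)|\ne|\mathrm{supp}(w)|$ for all distinct poset vectors $v,w$ of $A$), then $\mathrm{Aut}(A)=\{Q\in\mathfrak P_n: Q^TAQ=A\}$ is trivial, i.e., equals $\{I_n\}$.
   Context: Let $X_n=\{0,1,\ldots,n-1\}$. A naturally labeled (NL) poset on $X_n$ is a partial order $\preceq$ on $X_n$ such that $x\preceq y$ implies $x\le y$ in the usual integer order. Its poset matrix is the $n\times n$ $(0,1)$-matrix $A=(a_{i,j})_{i,j\in X_n}$ with $a_{i,j}=1$ if $j\preceq i$ and $0$ otherwise; $\mathcal{PM}(n)$ is the set of all such matrices. For a row vector $v\in\{0,1\}^n$, $A^v=\begin{bmatrix}A&\mathbf{0}\\ v&1\end{bmatrix}$, and $v$ is a poset vector of $A$ if $A^v\in\mathcal{PM}(n+1)$. $\mathrm{supp}(v)=\{j: v_j=1\}$. $\mathfrak P_n$ is the group of $n\times n$ permutation matrices. -}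

module Defs where

open import Algebra.Properties.Semiring.Sum using (sum)
open import Data.Bool.Base using (if_then_else_)
open import Data.Fin.Base as Fin using (Fin)
import Data.Fin.Properties as Fin
open import Data.Fin.Permutation using (Permutation′; _⟨$⟩ʳ_)
open import Data.Fin.Subset using (Subset)
open import Data.Nat.Base using (ℕ; _+_; _*_)
open import Data.Nat.Properties using (_≟_; +-*-semiring)
open import Data.Product.Base using (∃; _×_)
open import Data.Sum.Base using (_⊎_)
open import Data.Vec.Base using (tabulate)
open import Data.Vec.Functional using (Vector; _++_; zipWith; replicate; transpose)
open import Level using (0ℓ)
open import Relation.Binary.Core using (Rel)
open import Relation.Binary.Structures using (IsDecPartialOrder)
open import Relation.Binary.PropositionalEquality.Core using (_≡_)
open import Relation.Nullary.Decidable.Core using (Dec; does)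
open import Relation.Unary using (Pred; _∈_)

private
  variable
    m n k : ℕ

-- Matrices are functions, so they are compared entrywise by _≋_.
Matrix : ℕ → ℕ → Set
Matrix m n = Vector (Vector ℕ n) m

infix 4 _≋_
_≋_ : Rel (Matrix m n) 0ℓ
A ≋ B = ∀ i j → A i j ≡ B i j

infixl 7 _·_
_·_ : Matrix m n → Matrix n k → Matrix m k
(A · B) i j = sum +-*-semiring λ l → A i l * B l j

infix 8 _ᵀ
_ᵀ : Matrix m n → Matrix n m
_ᵀ = transpose

[_]₀₁ : {P : Set} → Dec P → ℕ
[ P? ]₀₁ = if does P? then 1 else 0

I : ∀ n → Matrix n n
I n i j = [ i Fin.≟ j ]₀₁

-- Decidability of ⪯ is automatic classically; here it is what makes the
-- 0/1 entries of the poset matrix definable.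
record NLPoset (n : ℕ) : Set₁ where
  infix 4 _⪯_
  field
    _⪯_               : Rel (Fin n) 0ℓ
    isDecPartialOrder : IsDecPartialOrder _≡_ _⪯_
    naturallyLabeled  : ∀ {x y} → x ⪯ y → x Fin.≤ y

  open IsDecPartialOrder isDecPartialOrder public renaming (_≤?_ to _⪯?_)

posetMatrix : NLPoset n → Matrix n n
posetMatrix P i j = [ j ⪯? i ]₀₁
  where open NLPoset P

PM : ∀ n → Pred (Matrix n n) _
PM n A = ∃ λ (P : NLPoset n) → A ≋ posetMatrix P

-- The block matrix with rows [ A 0 ] and [ v 1 ].
infix 8 _^_
_^_ : Matrix n n → Vector ℕ n → Matrix (n + 1) (n + 1)
_^_ {n} A v = zipWith _++_ A (replicate n (replicate 1 0))
           ++ replicate 1 (v ++ replicate 1 1)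

Is01 : Pred (Vector ℕ n) 0ℓ
Is01 v = ∀ j → v j ≡ 0 ⊎ v j ≡ 1

PosetVector : Matrix n n → Pred (Vector ℕ n) _
PosetVector {n} A v = Is01 v × A ^ v ∈ PM (n + 1)

supp : Vector ℕ n → Subset n
supp v = tabulate λ j → does (v j ≟ 1)

permutationMatrix : Permutation′ n → Matrix n n
permutationMatrix σ i j = [ σ ⟨$⟩ʳ i Fin.≟ j ]₀₁

𝔓 : ∀ n → Pred (Matrix n n) 0ℓ
𝔓 n Q = ∃ λ (σ : Permutation′ n) → Q ≋ permutationMatrix σ

Aut : Matrix n n → Pred (Matrix n n) 0ℓ
Aut {n} A Q = Q ∈ 𝔓 n × Q ᵀ · A · Q ≋ A

{-# OPTIONS --safe #-}
-- Poset vectors are the indicator vectors of the down-sets of the poset, and row i of A is the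
-- indicator of the principal down-set of i.  An automorphism σ carries the down-set of i onto that
-- of σ i, so these two rows have supports of equal size and hence coincide; antisymmetry then
-- gives σ i = i.
module Submission where

open import Defs
open import Data.Empty using (⊥)
open import Data.Fin.Base as Fin using (Fin; zero; suc; splitAt; join; toℕ)
import Data.Fin.Properties as Fin
open import Data.Fin.Permutation as Perm using (Permutation′; _⟨$⟩ʳ_)
open import Data.Fin.Subset using (∣_∣)
open import Data.Nat.Base using (ℕ; zero; suc; _+_; _*_)
import Data.Nat.Base as ℕ
import Data.Nat.Properties as ℕ
open import Algebra.Properties.Semiring.Sum ℕ.+-*-semiring using (sum; sum-cong-≋; sum-permute; sum-remove; sum-replicate-zero)
open import Data.Product.Base using (_,_)
open import Data.Sum.Base using (_⊎_; inj₁; inj₂)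
open import Data.Unit.Base using (⊤; tt)
open import Data.Vec.Functional using (Vector; removeAt)
open import Function.Base using (_∘_)
open import Function.Bundles using (_⇔_; mk⇔; Injection)
open import Function.Properties.Inverse using (↔⇒↣)
open import Level using (0ℓ)
open import Relation.Binary.Core using (Rel)
open import Relation.Binary.Definitions using (Decidable)
open import Relation.Binary.PropositionalEquality using (_≡_; refl; sym; trans; cong; subst₂; isEquivalence; module ≡-Reasoning; _≗_; _≢_)
open import Relation.Nullary using (¬_; Dec; yes; no; contradiction)
open import Relation.Nullary.Decidable using (decidable-stable)
open import Relation.Unary using (_∈_)

private
  variable
    n : ℕ

module _ {P : Set} where

  [_]₀₁-true : (P? : Dec P) → P → [ P? ]₀₁ ≡ 1
  [ yes _ ]₀₁-true _ = refl
  [ no ¬p ]₀₁-true p = contradiction p ¬p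

  [_]₀₁-false : (P? : Dec P) → ¬ P → [ P? ]₀₁ ≡ 0
  [ yes p ]₀₁-false ¬p = contradiction p ¬p
  [ no _ ]₀₁-false _ = refl

  [_]₀₁≡1 : (P? : Dec P) → [ P? ]₀₁ ≡ 1 → P
  [ yes p ]₀₁≡1 _ = p

  [_]₀₁-01 : (P? : Dec P) → [ P? ]₀₁ ≡ 0 ⊎ [ P? ]₀₁ ≡ 1
  [ yes _ ]₀₁-01 = inj₂ refl
  [ no _ ]₀₁-01 = inj₁ refl

01-indicator : ∀ {x} → x ≡ 0 ⊎ x ≡ 1 → x ≡ [ x ℕ.≟ 1 ]₀₁
01-indicator (inj₁ refl) = refl
01-indicator (inj₂ refl) = refl

-- Turns a cardinality into a sum, which can be reindexed along a permutation.
∣supp∣≡sum : ∀ {n} {v : Vector ℕ n} → Is01 v → ∣ supp v ∣ ≡ sum v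
∣supp∣≡sum {zero} _ = refl
∣supp∣≡sum {suc n} {v} v01 with v zero | v01 zero
... | _ | inj₁ refl = ∣supp∣≡sum (v01 ∘ suc)
... | _ | inj₂ refl = cong suc (∣supp∣≡sum (v01 ∘ suc))

sum-zero : ∀ {n} {v : Vector ℕ n} → (∀ i → v i ≡ 0) → sum v ≡ 0
sum-zero {n} v≗0 = trans (sum-cong-≋ v≗0) (sum-replicate-zero n)

sum-single : (v : Vector ℕ n) (i : Fin n) → (∀ l → l ≢ i → v l ≡ 0) → sum v ≡ v i
sum-single {suc n} v i v≡0 = begin
  sum v                       ≡⟨ sum-remove v ⟩
  v i + sum (removeAt v i)    ≡⟨ cong (v i +_) (sum-zero λ l → v≡0 _ (Fin.punchInᵢ≢i i l)) ⟩
  v i + 0                    ≡⟨ ℕ.+-identityʳ (v i) ⟩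
  v i                        ∎
  where open ≡-Reasoning

perm-injective : (σ : Permutation′ n) {i j : Fin n} → σ ⟨$⟩ʳ i ≡ σ ⟨$⟩ʳ j → i ≡ j
perm-injective σ = Injection.injective (↔⇒↣ σ)

module _ (σ : Permutation′ n) {Q : Matrix n n} (Q≋σ : Q ≋ permutationMatrix σ) where

  perm-diagonal : ∀ i → Q i (σ ⟨$⟩ʳ i) ≡ 1
  perm-diagonal i = trans (Q≋σ i _) ([ σ ⟨$⟩ʳ i Fin.≟ σ ⟨$⟩ʳ i ]₀₁-true refl)

  perm-off-diagonal : ∀ {l i} → l ≢ i → Q l (σ ⟨$⟩ʳ i) ≡ 0
  perm-off-diagonal {l} {i} l≢i = trans (Q≋σ l _) ([ σ ⟨$⟩ʳ l Fin.≟ σ ⟨$⟩ʳ i ]₀₁-false (l≢i ∘ perm-injective σ))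

  -- Column `σ ⟨$⟩ʳ i` of `Q` has its only 1 in row `i`, so both matrix-product sums collapse to one
  -- term. Reading the entry at the images of `i` and `j` avoids the inverse of `σ`.
  conjugate-entry : (A : Matrix n n) (i j : Fin n) →
    (Q ᵀ · A · Q) (σ ⟨$⟩ʳ i) (σ ⟨$⟩ʳ j) ≡ A i j
  conjugate-entry A i j = begin
    (Q ᵀ · A · Q) (σ ⟨$⟩ʳ i) (σ ⟨$⟩ʳ j)
      ≡⟨ sum-single _ j (λ l l≢j → trans
           (cong ((Q ᵀ · A) (σ ⟨$⟩ʳ i) l *_) (perm-off-diagonal l≢j))
           (ℕ.*-zeroʳ ((Q ᵀ · A) (σ ⟨$⟩ʳ i) l))) ⟩
    (Q ᵀ · A) (σ ⟨$⟩ʳ i) j * Q j (σ ⟨$⟩ʳ j)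
      ≡⟨ cong ((Q ᵀ · A) (σ ⟨$⟩ʳ i) j *_) (perm-diagonal j) ⟩
    (Q ᵀ · A) (σ ⟨$⟩ʳ i) j * 1
      ≡⟨ ℕ.*-identityʳ _ ⟩
    (Q ᵀ · A) (σ ⟨$⟩ʳ i) j
      ≡⟨ sum-single _ i (λ l l≢i → cong (_* A l j) (perm-off-diagonal l≢i)) ⟩
    Q i (σ ⟨$⟩ʳ i) * A i j
      ≡⟨ cong (_* A i j) (perm-diagonal i) ⟩
    1 * A i j
      ≡⟨ ℕ.*-identityˡ _ ⟩
    A i j ∎
    where open ≡-Reasoning

splitAt-injective : ∀ m {n} {x y : Fin (m + n)} → splitAt m x ≡ splitAt m y → x ≡ y
splitAt-injective m = Injection.injective (↔⇒↣ (Fin.+↔⊎ {m}))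

module _ (P : NLPoset n) (v : Vector ℕ n) where
  open NLPoset P using (_⪯_; _⪯?_) renaming (refl to ⪯-refl; trans to ⪯-trans; antisym to ⪯-antisym; naturallyLabeled to ⪯⇒≤)

  DownClosed : Set
  DownClosed = ∀ {i j} → j ⪯ i → v i ≡ 1 → v j ≡ 1

  module _ (down : DownClosed) where

    -- The new point `inj₂ zero` lies above exactly the support of `v` and below no old point, so it
    -- is maximal but not necessarily greatest. The disjoint union mirrors the block structure of
    -- `A ^ v`.
    _⊑_ : Rel (Fin n ⊎ Fin 1) 0ℓ
    inj₁ a ⊑ inj₁ b = a ⪯ b
    inj₁ a ⊑ inj₂ _ = v a ≡ 1
    inj₂ _ ⊑ inj₁ _ = ⊥
    inj₂ _ ⊑ inj₂ _ = ⊤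

    _⊑?_ : Decidable _⊑_
    inj₁ a ⊑? inj₁ b = a ⪯? b
    inj₁ a ⊑? inj₂ _ = v a ℕ.≟ 1
    inj₂ _ ⊑? inj₁ _ = no λ ()
    inj₂ _ ⊑? inj₂ _ = yes tt

    ⊑-reflexive : ∀ {x y} → x ≡ y → x ⊑ y
    ⊑-reflexive {inj₁ _} refl = ⪯-refl
    ⊑-reflexive {inj₂ _} refl = tt

    ⊑-trans : ∀ {x y z} → x ⊑ y → y ⊑ z → x ⊑ z
    ⊑-trans {inj₁ _} {inj₁ _} {inj₁ _} p q = ⪯-trans p q
    -- The one case that uses down-closure: below a point of the support means in the support.
    ⊑-trans {inj₁ _} {inj₁ _} {inj₂ _} p q = down p q
    ⊑-trans {inj₁ _} {inj₂ _} {inj₂ _} p _ = p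
    ⊑-trans {inj₂ _} {inj₂ _} {inj₂ _} _ _ = tt

    ⊑-antisym : ∀ {x y} → x ⊑ y → y ⊑ x → x ≡ y
    ⊑-antisym {inj₁ _} {inj₁ _} p q = cong inj₁ (⪯-antisym p q)
    ⊑-antisym {inj₂ zero} {inj₂ zero} _ _ = refl

    -- The new point gets label `n`, larger than every old label.
    ⊑⇒join-≤ : ∀ {x y} → x ⊑ y → join n 1 x Fin.≤ join n 1 y
    ⊑⇒join-≤ {inj₁ a} {inj₁ b} p =
      subst₂ ℕ._≤_ (sym (Fin.toℕ-↑ˡ a 1)) (sym (Fin.toℕ-↑ˡ b 1)) (⪯⇒≤ p)
    ⊑⇒join-≤ {inj₁ a} {inj₂ b} _ =
      subst₂ ℕ._≤_ (sym (Fin.toℕ-↑ˡ a 1)) (sym (Fin.toℕ-↑ʳ n b))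
        (ℕ.≤-trans (ℕ.<⇒≤ (Fin.toℕ<n a)) (ℕ.m≤m+n n (toℕ b)))
    ⊑⇒join-≤ {inj₂ zero} {inj₂ zero} _ = ℕ.≤-refl

    addTop : NLPoset (n + 1)
    addTop = record
      { _⪯_ = λ x y → splitAt n x ⊑ splitAt n y
      ; isDecPartialOrder = record
        { isPartialOrder = record
          { isPreorder = record
            { isEquivalence = isEquivalence
            ; reflexive = ⊑-reflexive ∘ cong (splitAt n)
            ; trans = λ {x y z} → ⊑-trans {splitAt n x} {splitAt n y} {splitAt n z}
            }
          ; antisym = λ p q → splitAt-injective n (⊑-antisym p q)
          }
        ; _≟_ = Fin._≟_
        ; _≤?_ = λ x y → splitAt n x ⊑? splitAt n y
        }
      ; naturallyLabeled = λ {x y} p →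
          subst₂ Fin._≤_ (Fin.join-splitAt n 1 x) (Fin.join-splitAt n 1 y)
            (⊑⇒join-≤ {splitAt n x} {splitAt n y} p)
      }

    addTop-matrix : {A : Matrix n n} → A ≋ posetMatrix P → Is01 v → A ^ v ≋ posetMatrix addTop
    addTop-matrix A≋P v01 x y with splitAt n x
    addTop-matrix A≋P v01 x y | inj₁ i with splitAt n y
    ... | inj₁ j = A≋P i j
    ... | inj₂ _ = refl
    addTop-matrix A≋P v01 x y | inj₂ _ with splitAt n y
    -- The poset matrix records here whether `v j` equals 1; for a 0/1 vector that is `v j` itself.
    ... | inj₁ j = 01-indicator (v01 j)
    ... | inj₂ _ = refl

    downClosed⇒posetVector : {A : Matrix n n} → A ≋ posetMatrix P → Is01 v → v ∈ PosetVector A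
    downClosed⇒posetVector A≋P v01 = v01 , addTop , addTop-matrix A≋P v01

module _ (P : NLPoset n) {A : Matrix n n} (A≋P : A ≋ posetMatrix P) where
  open NLPoset P using (_⪯_; _⪯?_) renaming (refl to ⪯-refl; trans to ⪯-trans; antisym to ⪯-antisym)

  entry⇒⪯ : ∀ {i j} → A i j ≡ 1 → j ⪯ i
  entry⇒⪯ {i} {j} e = [ j ⪯? i ]₀₁≡1 (trans (sym (A≋P i j)) e)

  ⪯⇒entry : ∀ {i j} → j ⪯ i → A i j ≡ 1
  ⪯⇒entry {i} {j} p = trans (A≋P i j) ([ j ⪯? i ]₀₁-true p)

  row-01 : ∀ i → Is01 (A i)
  row-01 i j rewrite A≋P i j = [ j ⪯? i ]₀₁-01

  -- Transitivity makes the principal down-set of `i` down-closed.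
  row-posetVector : ∀ i → A i ∈ PosetVector A
  row-posetVector i = downClosed⇒posetVector P (A i)
    (λ p e → ⪯⇒entry (⪯-trans p (entry⇒⪯ e))) A≋P (row-01 i)

  -- By reflexivity the diagonal entries are 1, so equal rows put `i` and `j` below each other.
  rows-injective : ∀ {i j} → A i ≗ A j → i ≡ j
  rows-injective {i} {j} eq =
    ⪯-antisym (entry⇒⪯ (trans (sym (eq i)) (⪯⇒entry ⪯-refl)))
              (entry⇒⪯ (trans (eq j) (⪯⇒entry ⪯-refl)))

  -- Reindexing the sum over row `σ ⟨$⟩ʳ i` by `σ` turns it term by term into the sum over row `i`.
  row-size-invariant : (σ : Permutation′ n) →
    (∀ i j → A (σ ⟨$⟩ʳ i) (σ ⟨$⟩ʳ j) ≡ A i j) →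
    ∀ i → ∣ supp (A (σ ⟨$⟩ʳ i)) ∣ ≡ ∣ supp (A i) ∣
  row-size-invariant σ inv i = begin
    ∣ supp (A (σ ⟨$⟩ʳ i)) ∣                ≡⟨ ∣supp∣≡sum (row-01 _) ⟩
    sum (A (σ ⟨$⟩ʳ i))                      ≡⟨ sum-permute (A (σ ⟨$⟩ʳ i)) σ ⟩
    sum (λ j → A (σ ⟨$⟩ʳ i) (σ ⟨$⟩ʳ j))     ≡⟨ sum-cong-≋ (inv i) ⟩
    sum (A i)                               ≡⟨ ∣supp∣≡sum (row-01 i) ⟨
    ∣ supp (A i) ∣                         ∎
    where open ≡-Reasoning

theorem3p5 : (n : ℕ) (A : Matrix n n) → A ∈ PM n →
    ((v w : Vector ℕ n) → v ∈ PosetVector A → w ∈ PosetVector A → ¬ (v ≗ w) → ∣ supp v ∣ ≢ ∣ supp w ∣) →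
    (Q : Matrix n n) → Q ∈ Aut A ⇔ Q ≋ I n
theorem3p5 n A (P , A≋P) distinct Q = mk⇔ trivial identity
  where
  trivial : Q ∈ Aut A → Q ≋ I n
  trivial ((σ , Q≋σ) , fixes) i j = trans (Q≋σ i j) (cong (λ k → [ k Fin.≟ j ]₀₁) (σ-fixes i))
    where
    σ-fixes : ∀ i → σ ⟨$⟩ʳ i ≡ i
    σ-fixes i = rows-injective P A≋P
      -- `distinct` only refutes that the rows differ. Equality of two rows is decidable, being
      -- finitely many equalities of naturals, so the double negation can be removed.
      (decidable-stable (Fin.all? λ j → A (σ ⟨$⟩ʳ i) j ℕ.≟ A i j) λ rows≢ →
        distinct _ _ (row-posetVector P A≋P _) (row-posetVector P A≋P i) rows≢
          (row-size-invariant P A≋P σ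
            (λ i j → trans (sym (fixes _ _)) (conjugate-entry σ Q≋σ A i j)) i))

  identity : Q ≋ I n → Q ∈ Aut A
  -- For `Perm.id` the permutation matrix reduces to `I n`, and `conjugate-entry` is then literally
  -- the equation defining an automorphism.
  identity Q≋I = (Perm.id , Q≋I) , conjugate-entry Perm.id Q≋I A
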